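{- Let $n,q\ge 1$ and $r\ge 3$ be integers and let $\sigma$ be a partition of $r$ with $s(\sigma)\ge 2$ and $\delta(\sigma)\ge 2$. Then the $\sigma$-hypergraph $\mathcal{H}(n,r,q|\sigma)$ does not have a gap in its NMNR spectrum.
   Context: For positive integers $n,r,q$ with $r\ge 3$ and a partition $\sigma$ of the integer $r$ (into positive parts), the $\sigma$-hypergraph $\mathcal{H}(n,r,q|\sigma)$ has $nq$ vertices, partitioned into $n$ classes $V_1,\dots,V_n$ each containing $q$ vertices; an $r$-subset $R$ of the vertices is an edge if and only if the non-zero cardinalities among $|R\cap V_i|$, $1\le i\le n$, form (as a multiset) the partition $\sigma$ of $r$. $\delta(\sigma)$ and $s(\sigma)$ denote the size of the smallest part and the number of parts (counted with multiplicity) of $\sigma$, respectively. It is assumed throughout that $s(\sigma)\ge 2$. A $k$-NMNR (non-monochromatic non-rainbow) colouring of a hypergraph is a colouring of its vertices using exactly $k$ distinct colours (all $k$ are used) such that no edge has all its vertices of the same colour and no edge has all its vertices of pairwise distinct colours. A hypergraph is $k$-NMNR colourable if it has a $k$-NMNR colouring. Its NMNR spectrum is the set of all positive integers $k$ for which it is $k$-NMNR colourable; the spectrum has a gap if there are $k_1<k_2<k_3$ with $k_1,k_3$ in the spectrum and $k_2$ not in the spectrum. -}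

module Defs where

open import Data.Fin using (Fin; quotient)
import Data.Fin.Properties as Fin
open import Data.Fin.Subset using (Subset; _∈_; _∩_; ∣_∣)
open import Data.List using (List; length; sum; filter; tabulate)
open import Data.List.Extrema.Nat using (min)
open import Data.List.Relation.Binary.Permutation.Propositional using (_↭_)
open import Data.List.Relation.Unary.All using (All)
open import Data.Nat using (ℕ; _*_; _≤_; _<_; _≟_)
open import Data.Product using (_×_; ∃; ∃-syntax)
import Data.Vec as Vec
open import Function.Definitions using (Surjective)
open import Level using (0ℓ)
open import Relation.Binary.PropositionalEquality using (_≡_; _≢_)
open import Relation.Nullary using (¬_; ¬?; does)
open import Relation.Unary using (Pred)

-- The parts are listed in an arbitrary order; they are only ever compared up
-- to permutation, that is, as a multiset.
record Partition (r : ℕ) : Set where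
  field
    parts    : List ℕ
    positive : All (0 <_) parts
    sum≡r    : sum parts ≡ r

s : ∀ {r} → Partition r → ℕ
s σ = length (Partition.parts σ)

-- `min r xs` is the minimum of r and the entries of xs.  No part exceeds r, so
-- the bound r has no effect as soon as there is a part.
δ : ∀ {r} → Partition r → ℕ
δ {r} σ = min r (Partition.parts σ)

record Hypergraph : Set₁ where
  field
    order : ℕ
    Edge  : Subset order → Set

  Vertex : Set
  Vertex = Fin order

-- The i-th block of q consecutive elements of Fin (n * q).
V : ∀ n q → Fin n → Subset (n * q)
V n q i = Vec.tabulate (λ v → does (quotient {n} q v Fin.≟ i))

nonZeroCardinalities : ∀ n q → Subset (n * q) → List ℕ
nonZeroCardinalities n q R =
  filter (λ m → ¬? (m ≟ 0)) (tabulate (λ i → ∣ R ∩ V n q i ∣))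

ℋ : (n r q : ℕ) → Partition r → Hypergraph
ℋ n r q σ = record
  { order = n * q
  ; Edge  = λ R → ∣ R ∣ ≡ r × nonZeroCardinalities n q R ↭ Partition.parts σ
  }

module _ (H : Hypergraph) where
  open Hypergraph H

  Monochromatic : ∀ {k} → (Vertex → Fin k) → Subset order → Set
  Monochromatic c R = ∀ {x y} → x ∈ R → y ∈ R → c x ≡ c y

  Rainbow : ∀ {k} → (Vertex → Fin k) → Subset order → Set
  Rainbow c R = ∀ {x y} → x ∈ R → y ∈ R → x ≢ y → c x ≢ c y

  IsNMNR : ∀ {k} → (Vertex → Fin k) → Set
  IsNMNR c = ∀ R → Edge R → ¬ Monochromatic c R × ¬ Rainbow c R

  -- Surjectivity says that all k colours are used.
  NMNRColourable : ℕ → Set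
  NMNRColourable k =
    ∃ λ (c : Vertex → Fin k) → Surjective _≡_ _≡_ c × IsNMNR c

  NMNRSpectrum : Pred ℕ 0ℓ
  NMNRSpectrum k = 1 ≤ k × NMNRColourable k

HasGap : Pred ℕ 0ℓ → Set
HasGap S = ∃[ k₁ ] ∃[ k₂ ] ∃[ k₃ ]
  k₁ < k₂ × k₂ < k₃ × S k₁ × ¬ S k₂ × S k₃

{-# OPTIONS --safe #-}
-- Every k in the spectrum is joined to n by an interval of the spectrum, so
-- there is no gap.  Since s(σ) ≥ 2 and δ(σ) ≥ 2, an edge neither lies inside a
-- class V_i nor meets it in exactly one vertex.  Hence two colours that occur
-- only inside V_i can be merged (one colour fewer), and V_i can be repainted
-- with a single colour that is used nowhere else.  If at most one colour is
-- confined to V_i, repainting adds at most one colour.  Treating the classes in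
-- turn, the number of colours moves in steps of at most one until every class
-- has a colour of its own, that is, until there are n colours.
module Submission where

open import Defs
open import Data.Fin using (Fin; zero; suc; _≟_; punchIn; punchOut; quotient; combine)
open import Data.Fin.Properties
  using (any?; 0≢1+n; suc-injective; punchOut-injective; punchOut-cong; punchOut-punchIn;
         punchInᵢ≢i; injective⇒≤; remQuot-combine)
open import Data.Fin.Subset using (Subset; _∈_; _∩_; ∣_∣; ⁅_⁆)
open import Data.Fin.Subset.Properties
  using (_∈?_; nonempty?; Empty-unique; ∣⊥∣≡0; p⊆q⇒∣p∣≤∣q∣; ∣⁅x⁆∣≡1; x∈⁅x⁆; x∈⁅y⁆⇒x≡y;
         x∈p∩q⁺; x∈p∩q⁻)
open import Data.List using (List; []; _∷_; length; filter; tabulate; allFin)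
open import Data.List.Extrema.Nat using (min≤xs)
open import Data.List.Membership.Propositional.Properties
  using (∈-filter⁺; ∈-tabulate⁺; ∈-allFin)
open import Data.List.Relation.Binary.Permutation.Propositional.Properties
  using (∈-resp-↭; ↭-length)
open import Data.List.Relation.Unary.All as All using (All; []; _∷_)
import Data.Nat as ℕ
open import Data.Nat using (ℕ; zero; suc; _≤_; s≤s; s≤s⁻¹)
open import Data.Nat.Properties
  using (≤-reflexive; ≤-trans; ≤-total; ≤-antisym; <⇒≤; m≤n⇒m<n∨m≡n; m<n⇒n≢0; <⇒≱)
open import Data.Product using (∃; _×_; _,_; proj₁; proj₂)
open import Data.Sum using (_⊎_; inj₁; inj₂; [_,_]′; swap)
open import Data.Vec.Properties using (lookup∘tabulate; []=⇒lookup; lookup⇒[]=)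
open import Function using (id; _∘_)
open import Function.Consequences.Propositional
  using (strictlySurjective⇒surjective; surjective⇒strictlySurjective)
open import Function.Definitions using (Injective; StrictlySurjective)
open import Relation.Binary.PropositionalEquality
  using (_≡_; _≢_; refl; sym; trans; cong; subst)
open import Relation.Nullary
  using (¬_; yes; no; ¬?; contradiction; _×-dec_)
open import Relation.Nullary.Decidable using (decidable-stable; dec-true; dec-false)
open import Relation.Unary using (Pred; Decidable)

-- Intervals of natural numbers inside a predicate

Between : ℕ → ℕ → ℕ → Set
Between k l j = (k ≤ j × j ≤ l) ⊎ (l ≤ j × j ≤ k)

-- Comparing `j` with `l` decides. As `l` may lie outside the interval from `k` to `m`, a chain of
-- recolourings may overshoot.
between-split : ∀ {k m j} l → Between k m j → Between k l j ⊎ Between l m j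
between-split {j = j} l (inj₁ (k≤j , j≤m)) with ≤-total j l
... | inj₁ j≤l = inj₁ (inj₁ (k≤j , j≤l))
... | inj₂ l≤j = inj₂ (inj₁ (l≤j , j≤m))
between-split {j = j} l (inj₂ (m≤j , j≤k)) with ≤-total j l
... | inj₁ j≤l = inj₂ (inj₂ (m≤j , j≤l))
... | inj₂ l≤j = inj₁ (inj₂ (l≤j , j≤k))

module _ {p} (S : Pred ℕ p) where

  Connected : ℕ → ℕ → Set p
  Connected k l = ∀ {j} → Between k l j → S j

  connected-sym : ∀ {k l} → Connected k l → Connected l k
  connected-sym kl = kl ∘ swap

  connected-trans : ∀ {k l m} → Connected k l → Connected l m → Connected k m
  connected-trans {l = l} kl lm = [ kl , lm ]′ ∘ between-split l

  connected-refl : ∀ {k} → S k → Connected k k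
  connected-refl Sk (inj₁ (k≤j , j≤k)) = subst S (≤-antisym k≤j j≤k) Sk
  connected-refl Sk (inj₂ (k≤j , j≤k)) = subst S (≤-antisym k≤j j≤k) Sk

  connected-suc : ∀ {k} → S k → S (suc k) → Connected k (suc k)
  connected-suc Sk Sk+1 (inj₁ (k≤j , j≤k+1)) with m≤n⇒m<n∨m≡n j≤k+1
  ... | inj₁ j<k+1 = connected-refl Sk (inj₁ (k≤j , s≤s⁻¹ j<k+1))
  ... | inj₂ refl  = Sk+1
  connected-suc Sk Sk+1 (inj₂ (k<j , j≤k)) = contradiction j≤k (<⇒≱ k<j)

-- Identifying two colours

module _ {k} {a b : Fin (suc k)} (b≢a : b ≢ a) where

  merge : Fin (suc k) → Fin k
  merge x with b ≟ x
  ... | yes _  = punchOut b≢a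
  ... | no b≢x = punchOut b≢x

  -- `punchOut` is injective, so different colours collide only through the value given to `b`,
  -- which is the image of `a`.
  merge-collision : ∀ {x y} → merge x ≡ merge y →
                    x ≡ y ⊎ ((x ≡ a ⊎ x ≡ b) × (y ≡ a ⊎ y ≡ b))
  merge-collision {x} {y} eq with b ≟ x | b ≟ y
  ... | yes b≡x | yes b≡y = inj₁ (trans (sym b≡x) b≡y)
  ... | yes b≡x | no  b≢y = inj₂ (inj₂ (sym b≡x) , inj₁ (sym (punchOut-injective b≢a b≢y eq)))
  ... | no  b≢x | yes b≡y = inj₂ (inj₁ (punchOut-injective b≢x b≢a eq) , inj₂ (sym b≡y))
  ... | no  b≢x | no  b≢y = inj₁ (punchOut-injective b≢x b≢y eq)

  merge-surjective : StrictlySurjective _≡_ merge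
  merge-surjective y = punchIn b y , merge-punchIn
    where
    merge-punchIn : merge (punchIn b y) ≡ y
    merge-punchIn with b ≟ punchIn b y
    ... | yes b≡ = contradiction (sym b≡) (punchInᵢ≢i b y)
    ... | no  _  = trans (punchOut-cong b refl) (punchOut-punchIn b)

-- Vertex classes that no edge lies inside or meets in a single vertex

module Blocks
  (H : Hypergraph)
  {n : ℕ} (block : Hypergraph.Vertex H → Fin n)
  (block-surjective : StrictlySurjective _≡_ block)
  (edge-leaves : ∀ {R} → Hypergraph.Edge H R → ∀ i → ∃ λ y → y ∈ R × block y ≢ i)
  (edge-repeats : ∀ {R} → Hypergraph.Edge H R → ∀ {x} → x ∈ R →
                  ∃ λ y → y ∈ R × y ≢ x × block y ≡ block x)
  where

  open Hypergraph H

  record Colouring (k : ℕ) : Set where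
    constructor colouring
    field
      colour     : Vertex → Fin k
      surjective : StrictlySurjective _≡_ colour
      nmnr       : IsNMNR H colour

    colourable : NMNRColourable H k
    colourable = colour , strictlySurjective⇒surjective surjective , nmnr

  open Colouring

  -- The first half keeps the colours of class `i` out of the other classes, the second makes the
  -- class monochromatic. Together they make it exactly one colour class.
  Isolated : ∀ {k} → (Vertex → Fin k) → Fin n → Set
  Isolated c i = ∀ {v w} → block v ≡ i →
    (c v ≡ c w → block w ≡ i) × (block w ≡ i → c v ≡ c w)

  Escapes : ∀ {k} → (Vertex → Fin k) → Fin n → Fin k → Set
  Escapes c i x = ∃ λ v → c v ≡ x × block v ≢ i

  escapes? : ∀ {k} (c : Vertex → Fin k) i → Decidable (Escapes c i)
  escapes? c i x = any? (λ v → (c v ≟ x) ×-dec ¬? (block v ≟ i))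

  confined : ∀ {k} {c : Vertex → Fin k} {i x v} → ¬ Escapes c i x → c v ≡ x → block v ≡ i
  confined ¬esc cv≡x = decidable-stable (_ ≟ _) (λ v∉i → ¬esc (_ , cv≡x , v∉i))

  module Merge {k} (C : Colouring (suc k)) {i : Fin n} {a b : Fin (suc k)} (b≢a : b ≢ a)
    (¬esc-a : ¬ Escapes (colour C) i a) (¬esc-b : ¬ Escapes (colour C) i b) where

    private
      c = colour C

      confined-ab : ∀ {v} → c v ≡ a ⊎ c v ≡ b → block v ≡ i
      confined-ab = [ confined ¬esc-a , confined ¬esc-b ]′

      collision : ∀ {v w} → merge b≢a (c v) ≡ merge b≢a (c w) →
                  c v ≡ c w ⊎ (block v ≡ i × block w ≡ i)
      collision eq with merge-collision b≢a eq
      ... | inj₁ cv≡cw      = inj₁ cv≡cw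
      ... | inj₂ (cv , cw) = inj₂ (confined-ab cv , confined-ab cw)

    merged : Colouring k
    merged .colour = merge b≢a ∘ c
    merged .surjective y =
      let x , mx≡y = merge-surjective b≢a y
          v , cv≡x = surjective C x
      in v , trans (cong (merge b≢a) cv≡x) mx≡y
    merged .nmnr R edge =
      (λ mono → proj₁ (nmnr C R edge) (unmerged mono)) ,
      -- Merging preserves equality of colours, so an edge that is rainbow afterwards was rainbow
      -- before.
      (λ rainbow → proj₂ (nmnr C R edge) (λ x∈R y∈R x≢y → rainbow x∈R y∈R x≢y ∘ cong (merge b≢a)))
      where
      -- A vertex of R outside V_i has a colour untouched by the merging.
      unmerged : Monochromatic H (merge b≢a ∘ c) R → Monochromatic H c R
      unmerged mono x∈R y∈R =
        let z , z∈R , z∉i = edge-leaves edge i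
            same : ∀ {x} → x ∈ R → c x ≡ c z
            same x∈R = [ id , (λ (_ , z∈i) → contradiction z∈i z∉i) ]′ (collision (mono x∈R z∈R))
        in trans (same x∈R) (sym (same y∈R))

    merged-isolated : ∀ {j} → j ≢ i → Isolated c j → Isolated (colour merged) j
    merged-isolated j≢i iso refl =
      -- A new collision has both vertices in class `i`, whereas `v` lies in class `j`.
      [ proj₁ (iso refl) , (λ (v∈i , _) → contradiction v∈i j≢i) ]′ ∘ collision ,
      cong (merge b≢a) ∘ proj₂ (iso refl)

  -- `f` carries the old colours into the new palette and `e` is the colour given to class `i`:
  -- `f = id` recycles a colour, `f = suc` frees `zero` for a new one. `cover` ensures that every
  -- colour of the new palette is used after class `i` is overpainted.
  module Repaint {k l} (C : Colouring k) (i : Fin n) (f : Fin k → Fin l)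
    (f-injective : Injective _≡_ _≡_ f) (e : Fin l)
    (fresh : ∀ {v} → block v ≢ i → f (colour C v) ≢ e)
    (cover : ∀ y → y ≡ e ⊎ ∃ λ x → Escapes (colour C) i x × f x ≡ y) where

    private
      c = colour C

      paint : Vertex → Fin l
      paint v with block v ≟ i
      ... | yes _ = e
      ... | no  _ = f (c v)

      paint-inside : ∀ {v} → block v ≡ i → paint v ≡ e
      paint-inside {v} v∈i with block v ≟ i
      ... | yes _   = refl
      ... | no  v∉i = contradiction v∈i v∉i

      paint-outside : ∀ {v} → block v ≢ i → paint v ≡ f (c v)
      paint-outside {v} v∉i with block v ≟ i
      ... | yes v∈i = contradiction v∈i v∉i
      ... | no  _   = refl

      paint-separates : ∀ {v w} → block v ≡ i → block w ≢ i → paint v ≢ paint w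
      paint-separates v∈i w∉i eq =
        fresh w∉i (trans (sym (paint-outside w∉i)) (trans (sym eq) (paint-inside v∈i)))

      paint-injective : ∀ {v w} → block v ≢ i → block w ≢ i → paint v ≡ paint w → c v ≡ c w
      paint-injective v∉i w∉i eq =
        f-injective (trans (sym (paint-outside v∉i)) (trans eq (paint-outside w∉i)))

    repainted : Colouring l
    repainted .colour = paint
    repainted .surjective y with cover y
    ... | inj₁ refl = let v , v∈i = block-surjective i in v , paint-inside v∈i
    ... | inj₂ (_ , (v , refl , v∉i) , fx≡y) = v , trans (paint-outside v∉i) fx≡y
    -- A bad edge turns out to avoid class `i`. Outside that class `paint` is `c` followed by an
    -- injection, so the edge was bad before.
    repainted .nmnr R edge = ¬mono , ¬rainbow
      where
      ¬mono : ¬ Monochromatic H paint R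
      ¬mono mono = proj₁ (nmnr C R edge) (λ x∈R y∈R →
        paint-injective (outside x∈R) (outside y∈R) (mono x∈R y∈R))
        where
        outside : ∀ {x} → x ∈ R → block x ≢ i
        outside x∈R x∈i =
          -- An edge meeting class `i` has colour `e` there and, since it leaves the class, another
          -- colour outside.
          let z , z∈R , z∉i = edge-leaves edge i
          in paint-separates x∈i z∉i (mono x∈R z∈R)

      ¬rainbow : ¬ Rainbow H paint R
      ¬rainbow rainbow = proj₂ (nmnr C R edge) (λ x∈R y∈R x≢y cx≡cy →
        rainbow x∈R y∈R x≢y
          (trans (paint-outside (outside x∈R))
            (trans (cong f cx≡cy) (sym (paint-outside (outside y∈R))))))
        where
        outside : ∀ {x} → x ∈ R → block x ≢ i
        outside x∈R x∈i =
          -- A second vertex of the edge in class `i` would share the colour `e`.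
          let y , y∈R , y≢x , y~x = edge-repeats edge x∈R
          in rainbow y∈R x∈R y≢x (trans (paint-inside (trans y~x x∈i)) (sym (paint-inside x∈i)))

    repainted-isolates : Isolated paint i
    repainted-isolates v∈i =
      (λ eq → decidable-stable (_ ≟ _) (λ w∉i → paint-separates v∈i w∉i eq)) ,
      (λ w∈i → trans (paint-inside v∈i) (sym (paint-inside w∈i)))

    repainted-isolated : ∀ {j} → j ≢ i → Isolated c j → Isolated paint j
    repainted-isolated j≢i iso {v} {w} refl = to , from
      where
      to : paint v ≡ paint w → block w ≡ block v
      to eq = proj₁ (iso refl)
        (paint-injective j≢i (λ w∈i → paint-separates w∈i j≢i (sym eq)) eq)

      from : block w ≡ block v → paint v ≡ paint w
      from w~v =
        trans (paint-outside j≢i)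
          (trans (cong f (proj₂ (iso refl) w~v)) (sym (paint-outside (j≢i ∘ trans (sym w~v)))))

  -- Isolating the classes one after another

  record Deformation {k} (C : Colouring k) (is : List (Fin n)) : Set where
    constructor deformation
    field
      {colours} : ℕ
      result    : Colouring colours
      connected : Connected (NMNRColourable H) k colours
      isolates  : All (Isolated (colour result)) is
      preserves : ∀ {j} → Isolated (colour C) j → Isolated (colour result) j

  isolating : ∀ {k l} {C : Colouring k} (C′ : Colouring l) {i} →
    Connected (NMNRColourable H) k l → Isolated (colour C′) i →
    (∀ {j} → j ≢ i → Isolated (colour C) j → Isolated (colour C′) j) →
    Deformation C (i ∷ [])
  isolating {C = C} C′ {i} conn iso pres = deformation C′ conn (iso ∷ []) preserves
    where
    preserves : ∀ {j} → Isolated (colour C) j → Isolated (colour C′) j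
    preserves {j} with j ≟ i
    ... | yes refl = λ _ → iso
    ... | no  j≢i  = pres j≢i

  -- Recursion on the number of colours, which merging lowers until at most one colour is confined
  -- to class `i`.
  isolate : ∀ {k} (C : Colouring k) i → Deformation C (i ∷ [])
  isolate {zero} C i with () ← colour C (proj₁ (block-surjective i))
  isolate {suc k} C i
    with any? (λ a → any? (λ b → ¬? (b ≟ a) ×-dec ¬? (escapes? (colour C) i a)
                                           ×-dec ¬? (escapes? (colour C) i b)))
  ... | yes (a , b , b≢a , ¬esc-a , ¬esc-b) =
    isolating C′
      (connected-trans S (connected-sym S (connected-suc S (colourable merged) (colourable C))) conn)
      (All.head iso)
      (λ j≢i → pres ∘ merged-isolated j≢i)
    where
    S = NMNRColourable H
    open Merge C b≢a ¬esc-a ¬esc-b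
    open Deformation (isolate merged i) renaming
      (result to C′; connected to conn; isolates to iso; preserves to pres)
  ... | no ¬two with any? (λ e → ¬? (escapes? (colour C) i e))
  -- Exactly one colour is confined. It is reused, so the number of colours stays the same.
  ...   | yes (e , ¬esc) =
    isolating repainted (connected-refl (NMNRColourable H) (colourable C))
      repainted-isolates repainted-isolated
    where
    cover : ∀ y → y ≡ e ⊎ ∃ λ x → Escapes (colour C) i x × x ≡ y
    cover y with y ≟ e
    ... | yes y≡e = inj₁ y≡e
    -- If `y` did not escape, `e` and `y` would be two confined colours.
    ... | no  y≢e = inj₂ (y , decidable-stable (escapes? (colour C) i y)
                                (λ ¬esc-y → ¬two (e , y , y≢e , ¬esc , ¬esc-y)) , refl)
    open Repaint C i id id e (λ v∉i cv≡e → v∉i (confined ¬esc cv≡e)) cover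
  -- Every colour also occurs outside class `i`, so none is lost and `zero` is added.
  ...   | no ¬one =
    isolating repainted
      (connected-suc (NMNRColourable H) (colourable C) (colourable repainted))
      repainted-isolates repainted-isolated
    where
    cover : ∀ y → y ≡ zero ⊎ ∃ λ x → Escapes (colour C) i x × suc x ≡ y
    cover zero    = inj₁ refl
    cover (suc y) = inj₂ (y , decidable-stable (escapes? (colour C) i y)
                            (λ ¬esc → ¬one (y , ¬esc)) , refl)
    open Repaint C i suc suc-injective zero (λ _ → 0≢1+n ∘ sym) cover

  isolateAll : ∀ {k} (C : Colouring k) is → Deformation C is
  isolateAll C [] = deformation C (connected-refl (NMNRColourable H) (colourable C)) [] id
  isolateAll C (i ∷ is) =
    deformation R.result (connected-trans (NMNRColourable H) I.connected R.connected)
      -- Class `i` is isolated first and stays so while the remaining classes are treated.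
      (R.preserves (All.head I.isolates) ∷ R.isolates) (R.preserves ∘ I.preserves)
    where
    module I = Deformation (isolate C i)
    module R = Deformation (isolateAll I.result is)

  -- Choosing a vertex of each colour and a vertex of each class gives injections in both
  -- directions, one from each half of `Isolated`.
  isolated⇒n-colours : ∀ {k} (C : Colouring k) → (∀ i → Isolated (colour C) i) → k ≡ n
  isolated⇒n-colours {k} C iso = ≤-antisym (injective⇒≤ colour⇒block) (injective⇒≤ block⇒colour)
    where
    colour⇒block : Injective _≡_ _≡_ (λ x → block (proj₁ (surjective C x)))
    colour⇒block {x} {y} eq =
      trans (sym (proj₂ (surjective C x)))
        (trans (proj₂ (iso _ refl) (sym eq)) (proj₂ (surjective C y)))

    block⇒colour : Injective _≡_ _≡_ (λ i → colour C (proj₁ (block-surjective i)))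
    block⇒colour {i} {j} eq =
      trans (sym (proj₁ (iso i (proj₂ (block-surjective i))) eq)) (proj₂ (block-surjective j))

  connected-n : ∀ {k} → NMNRColourable H k → Connected (NMNRColourable H) k n
  connected-n (c , surj , nmnr) =
    subst (Connected (NMNRColourable H) _)
      (isolated⇒n-colours result (λ i → All.lookup isolates (∈-allFin i))) connected
    where
    open Deformation
      (isolateAll (colouring c (surjective⇒strictlySurjective surj) nmnr) (allFin n))

  noGap : ¬ HasGap (NMNRSpectrum H)
  noGap (k₁ , k₂ , k₃ , k₁<k₂ , k₂<k₃ , (1≤k₁ , S₁) , ¬S₂ , (_ , S₃)) =
    ¬S₂ (≤-trans 1≤k₁ (<⇒≤ k₁<k₂) , S₂)
    where
    S₂ : NMNRColourable H k₂
    -- Below `n` the value `k₂` is reached from `k₁`, above `n` from `k₃`.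
    S₂ with ≤-total k₂ n
    ... | inj₁ k₂≤n = connected-n S₁ (inj₁ (<⇒≤ k₁<k₂ , k₂≤n))
    ... | inj₂ n≤k₂ = connected-n S₃ (inj₂ (n≤k₂ , <⇒≤ k₂<k₃))

-- Filtered tables and sizes of subsets

module _ {a p} {A : Set a} {P : Pred A p} (P? : Decidable P) where

  filter-tabulate-nonempty : ∀ {n} (f : Fin n → A) →
    1 ≤ length (filter P? (tabulate f)) → ∃ λ j → P (f j)
  filter-tabulate-nonempty {suc n} f 1≤ with P? (f zero)
  ... | yes Pf0 = zero , Pf0
  ... | no  _   = let j , Pfj = filter-tabulate-nonempty (f ∘ suc) 1≤ in suc j , Pfj

  -- Index `i` accounts for at most one kept entry, so a second one sits elsewhere. This will supply
  -- a class other than `V_i` that an edge meets.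
  filter-tabulate-other : ∀ {n} (f : Fin n → A) →
    2 ≤ length (filter P? (tabulate f)) → ∀ i → ∃ λ j → j ≢ i × P (f j)
  filter-tabulate-other {suc n} f 2≤ i with P? (f zero)
  filter-tabulate-other {suc n} f 2≤ zero    | yes _ =
    let j , Pfj = filter-tabulate-nonempty (f ∘ suc) (s≤s⁻¹ 2≤) in suc j , 0≢1+n ∘ sym , Pfj
  filter-tabulate-other {suc n} f 2≤ (suc i) | yes Pf0 = zero , 0≢1+n , Pf0
  filter-tabulate-other {suc n} f 2≤ zero    | no _ =
    let j , Pfj = filter-tabulate-nonempty (f ∘ suc) (<⇒≤ 2≤) in suc j , 0≢1+n ∘ sym , Pfj
  filter-tabulate-other {suc n} f 2≤ (suc i) | no _ =
    let j , j≢i , Pfj = filter-tabulate-other (f ∘ suc) 2≤ i in suc j , j≢i ∘ suc-injective , Pfj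

∣p∣≢0⇒nonempty : ∀ {m} (p : Subset m) → ∣ p ∣ ≢ 0 → ∃ (_∈ p)
∣p∣≢0⇒nonempty {m} p ∣p∣≢0 = decidable-stable (nonempty? p)
  (λ empty → ∣p∣≢0 (trans (cong ∣_∣ (Empty-unique empty)) (∣⊥∣≡0 m)))

-- Otherwise `p` would lie in the singleton of `x`, which has size 1.
2≤∣p∣⇒other : ∀ {m} {p : Subset m} → 2 ≤ ∣ p ∣ → ∀ x → ∃ λ y → y ∈ p × y ≢ x
2≤∣p∣⇒other {p = p} 2≤∣p∣ x = decidable-stable (any? (λ y → (y ∈? p) ×-dec ¬? (y ≟ x)))
  (λ none → <⇒≱ 2≤∣p∣ (≤-trans (p⊆q⇒∣p∣≤∣q∣ (p⊆⁅x⁆ none)) (≤-reflexive (∣⁅x⁆∣≡1 x))))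
  where
  p⊆⁅x⁆ : ¬ (∃ λ y → y ∈ p × y ≢ x) → ∀ {y} → y ∈ p → y ∈ ⁅ x ⁆
  p⊆⁅x⁆ none {y} y∈p =
    subst (_∈ ⁅ x ⁆) (sym (decidable-stable (y ≟ x) (λ y≢x → none (y , y∈p , y≢x)))) (x∈⁅x⁆ x)

x∈p⇒∣p∣≢0 : ∀ {m x} {p : Subset m} → x ∈ p → ∣ p ∣ ≢ 0
x∈p⇒∣p∣≢0 {x = x} x∈p = m<n⇒n≢0 (≤-trans (≤-reflexive (sym (∣⁅x⁆∣≡1 x)))
  (p⊆q⇒∣p∣≤∣q∣ (λ y∈⁅x⁆ → subst (_∈ _) (sym (x∈⁅y⁆⇒x≡y x y∈⁅x⁆)) x∈p)))

-- Classes and edges of the σ-hypergraph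

module _ {n q : ℕ} where

  ∈V⇒quotient : ∀ {i v} → v ∈ V n q i → quotient {n} q v ≡ i
  ∈V⇒quotient {i} {v} v∈Vi = decidable-stable (_ ≟ _) (λ v∉i →
    contradiction (trans (sym (dec-false (_ ≟ _) v∉i))
      (trans (sym (lookup∘tabulate _ v)) ([]=⇒lookup v∈Vi))) λ ())

  ∈V-quotient : ∀ v → v ∈ V n q (quotient {n} q v)
  ∈V-quotient v = lookup⇒[]= v _
    (trans (lookup∘tabulate _ v) (dec-true (quotient {n} q v ≟ quotient {n} q v) refl))

  quotient-surjective : 1 ≤ q → StrictlySurjective _≡_ (quotient {n} q)
  -- The witness is the first vertex of the `i`-th block, which exists as `q` is positive.
  quotient-surjective (s≤s _) i = combine i zero , cong proj₁ (remQuot-combine {n} i zero)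

module _ {n r q : ℕ} (σ : Partition r) {R : Subset (n ℕ.* q)}
  (edge : Hypergraph.Edge (ℋ n r q σ) R) where

  -- An edge has as many nonzero cardinalities as `σ` has parts, so it meets two classes, one of
  -- which is not `V_i`.
  ℋ-edge-leaves : 2 ≤ s σ → ∀ i → ∃ λ y → y ∈ R × quotient {n} q y ≢ i
  ℋ-edge-leaves 2≤s i =
    let j , j≢i , ∣R∩Vj∣≢0 = filter-tabulate-other (λ m → ¬? (m ℕ.≟ 0)) _
                               (subst (2 ≤_) (sym (↭-length (proj₂ edge))) 2≤s) i
        y , y∈R∩Vj = ∣p∣≢0⇒nonempty (R ∩ V n q j) ∣R∩Vj∣≢0
        y∈R , y∈Vj = x∈p∩q⁻ R (V n q j) y∈R∩Vj
    in y , y∈R , j≢i ∘ trans (sym (∈V⇒quotient {n} {q} y∈Vj))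

  ℋ-edge-repeats : 2 ≤ δ σ → ∀ {x} → x ∈ R →
    ∃ λ y → y ∈ R × y ≢ x × quotient {n} q y ≡ quotient {n} q x
  ℋ-edge-repeats 2≤δ {x} x∈R =
    let y , y∈R∩Vi , y≢x = 2≤∣p∣⇒other 2≤∣R∩Vi∣ x
        y∈R , y∈Vi = x∈p∩q⁻ R (V n q i) y∈R∩Vi
    in y , y∈R , y≢x , ∈V⇒quotient {n} {q} y∈Vi
    where
    i = quotient {n} q x

    2≤∣R∩Vi∣ : 2 ≤ ∣ R ∩ V n q i ∣
    -- The cardinality is nonzero because of `x`, so it is a part of `σ` and at least `δ σ`.
    2≤∣R∩Vi∣ = ≤-trans 2≤δ (All.lookup (min≤xs r (Partition.parts σ))
      (∈-resp-↭ (proj₂ edge)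
        (∈-filter⁺ (λ m → ¬? (m ℕ.≟ 0)) (∈-tabulate⁺ {f = λ i → ∣ R ∩ V n q i ∣} i)
          (x∈p⇒∣p∣≢0 (x∈p∩q⁺ (x∈R , ∈V-quotient {n} x))))))

theorem3p9 : (n r q : ℕ) → 1 ≤ n → 1 ≤ q → 3 ≤ r →
    (σ : Partition r) → 2 ≤ s σ → 2 ≤ δ σ →
    ¬ HasGap (NMNRSpectrum (ℋ n r q σ))
theorem3p9 n r q _ 1≤q _ σ 2≤s 2≤δ =
  Blocks.noGap (ℋ n r q σ) (quotient {n} q) (quotient-surjective 1≤q)
    (λ edge → ℋ-edge-leaves σ edge 2≤s) (λ edge → ℋ-edge-repeats σ edge 2≤δ)
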